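{- Let $p>3$ be a prime. Then $$\sum_{k=0}^{\frac{p-1}{2}} (6k+1) \left(\frac{(\frac12)_k}{k!}\right)^3 4^{ -k}\equiv (-1)^{\frac{p-1}{2}}p \pmod{p^4}.$$
   Context: For $a\in\mathbb{C}$ and $k\in\mathbb{N}$, $(a)_k=a(a+1)\cdots(a+k-1)$ denotes the rising factorial, with $(a)_0=1$. A congruence $A\equiv B \pmod{p^m}$ between rational numbers means that $A-B\in p^m\mathbb{Z}_{(p)}$. -}

module Defs where

open import Data.Nat as ℕ using (ℕ; zero; suc; _!)
open import Data.Nat.Properties using (m^n≢0; _!≢0)
open import Data.Nat.Divisibility using (_∣_)
open import Data.Integer as ℤ using (ℤ; +_)
open import Data.Rational as ℚ using (ℚ; _+_; _*_; _-_; _/_)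
open import Data.Product using (∃₂; _×_)
open import Relation.Nullary using (¬_)
open import Relation.Binary.PropositionalEquality using (_≡_)

rising : ℚ → ℕ → ℚ
rising a zero    = ℚ.1ℚ
rising a (suc k) = rising a k * (a + (+ k / 1))

half : ℚ
half = + 1 / 2

inv4^ : ℕ → ℚ
inv4^ k = _/_ (+ 1) (4 ℕ.^ k) {{m^n≢0 4 k}}

ratio : ℕ → ℚ
ratio k = rising half k * _/_ (+ 1) (k !) {{k !≢0}}

sumTo : ℕ → (ℕ → ℚ) → ℚ
sumTo zero    f = f 0
sumTo (suc n) f = sumTo n f + f (suc n)

ℤ→ℚ : ℤ → ℚ
ℤ→ℚ z = z / 1

-- A ≡ B (mod p^m) for rationals: A - B ∈ p^m ℤ_(p), i.e.
-- A - B = p^m * (a / b) with a, b integers, b ≠ 0 and p ∤ b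
-- (p ∤ b already implies b ≠ 0).
_≡_[modℚ_^_] : ℚ → ℚ → ℕ → ℕ → Set
A ≡ B [modℚ p ^ m ] =
  ∃₂ λ (a : ℤ) (b : ℕ) → ¬ (p ∣ b) ×
    ((A - B) * ℤ→ℚ (+ b) ≡ ℤ→ℚ (+ (p ℕ.^ m)) * ℤ→ℚ a)

term : ℕ → ℚ
term k = ℤ→ℚ (+ (6 ℕ.* k ℕ.+ 1)) * (ratio k * ratio k * ratio k) * inv4^ k

sign : ℕ → ℚ
sign zero    = ℚ.1ℚ
sign (suc n) = ℚ.- sign n

{-# OPTIONS --safe #-}

-- Put m = (p - 1)/2 and replace two of the three factors (1/2)_k by (1/2 + x)_k (1/2 - x)_k, and
-- k!² by (1 + x/2)_k (1 - x/2)_k.  Clearing denominators in the sum up to m gives an integer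
-- polynomial N of degree m in X = (2x)², with N(0) = K R(0) · (sum), where K = 2^m m! and
-- R(X) = ∏_{l=1}^m (16 l² - X).  A telescoping (WZ type) argument relates N((o+4)²) to N(o²) for
-- odd o, as long as both lie among the squares of 1, 3, …, p.  It has two consequences.
--  * N((2j+1)²) = (-1)^j (2j+1) K R((2j+1)²); in particular N(p²) = (-1)^m p K R(p²).
--  * N, and after division by p also N/p, takes the same value mod p at the m + 1 points (2j+1)²,
--    which are distinct mod p.  Since p ∣ N(p²), N/p is integral, and N/p is constant mod p, so
--    its linear coefficient vanishes mod p and N(p²) ≡ N(0) mod p⁴.
-- Finally R(p²) ≡ R(0) mod p³: the roots of R mod p are the nonzero squares, so R(4X) - 4^m R(X)
-- has m roots but degree < m and vanishes mod p; comparing the coefficients of 1 and X shows that p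
-- divides 4^m - 1 and three times the linear coefficient of R.
module Submission where

open import Defs
open import Data.Nat as ℕ using (ℕ; zero; suc; z≤n; s≤s; _<_; _≤_; _∸_; _!)
open import Data.Nat.Primality using (Prime; euclidsLemma; prime⇒irreducible)
import Data.Nat.Properties as ℕ
import Data.Nat.Divisibility as ℕ
import Data.Nat.DivMod as ℕ
open import Data.Integer as ℤ using (ℤ; +_; -[1+_]; 0ℤ; 1ℤ)
import Data.Integer.Properties as ℤ
open import Data.Product using (∃-syntax; _×_; _,_; proj₁; proj₂)
open import Data.Sum using (inj₁; inj₂)
open import Relation.Nullary using (¬_; yes; no; contradiction)
open import Relation.Binary.PropositionalEquality

module Integral where

  open import Data.Integer using (-_; _+_; _*_; _-_; ≢-nonZero; _^_)
  open import Data.Integer.Properties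
  open import Data.Integer.Divisibility.Signed
  open import Data.Integer.Tactic.RingSolver using (solve-∀)
  open import Data.Vec using (Vec; []; _∷_; map)
  open import Data.Vec.Relation.Unary.All using (All; []; _∷_)

  -- The deformed sum with its denominators cleared.

  odd : ℤ → ℤ
  odd n = + 2 * n + 1ℤ

  -- `O k` is 2^k (1/2)_k and `K k` is 2^k k!, so `O k` over `K k` is the undeformed factor (1/2)_k
  -- / k!.
  O : ℕ → ℤ
  O zero    = 1ℤ
  O (suc k) = O k * odd (+ k)

  K : ℕ → ℤ
  K zero    = 1ℤ
  K (suc k) = K k * (+ 2 * + suc k)

  -- With x = (2t)², `E k x` is 4^k (1/2 + t)_k (1/2 - t)_k and `R k x` is 16^k (1 + t/2)_k (1 -
  -- t/2)_k; their quotient absorbs the factor 4^(-k).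
  E : ℕ → ℤ → ℤ
  E zero    x = 1ℤ
  E (suc k) x = E k x * (odd (+ k) * odd (+ k) - x)

  R : ℕ → ℤ → ℤ
  R zero    x = 1ℤ
  R (suc k) x = R k x * (+ 16 * (+ suc k * + suc k) - x)

  -- The sum of the deformed terms up to k, times its denominator K k * R k x.
  N : ℕ → ℤ → ℤ
  N zero    x = 1ℤ
  N (suc k) x = N k x * (+ 2 * + suc k * (+ 16 * (+ suc k * + suc k) - x))
              + (+ 6 * + suc k + 1ℤ) * O (suc k) * E (suc k) x

  -- The common factor of E (suc k) at o² and at (o + 4)².
  common : ℕ → ℤ → ℤ
  common zero    o = 1ℤ
  common (suc k) o = common k o * ((+ 2 * + k - 1ℤ - o) * (+ 2 * + k + + 3 + o))

  -- The shift from `o` to `o + 4`.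

  sq : ℤ → ℤ
  sq o = o * o

  -- `E (suc k)` at `o²` is the product over j ≤ k of (2j + 1 - o)(2j + 1 + o). Writing 1 + o as
  -- -(-1 - o) moves it to the first family and produces the minus sign; for `E-sq+4`, -3 - o = -(3
  -- + o) moves the other way.
  E-sq : ∀ k o → E (suc k) (sq o) ≡ - (common k o * ((+ 2 * + k - 1ℤ - o) * (+ 2 * + k + 1ℤ - o)))
  E-sq zero    o = base o
    where
    base : ∀ o → 1ℤ * ((+ 2 * + 0 + 1ℤ) * (+ 2 * + 0 + 1ℤ) - o * o) ≡ - (1ℤ * ((+ 2 * + 0 - 1ℤ - o) * (+ 2 * + 0 + 1ℤ - o)))
    base = solve-∀
  E-sq (suc k) o = trans (cong (_* (odd (+ suc k) * odd (+ suc k) - sq o)) (E-sq k o)) (step (+ k) o (common k o))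
    where
    step : ∀ k o h → (- (h * ((+ 2 * k - 1ℤ - o) * (+ 2 * k + 1ℤ - o)))) * ((+ 2 * (1ℤ + k) + 1ℤ) * (+ 2 * (1ℤ + k) + 1ℤ) - o * o)
      ≡ - (h * ((+ 2 * k - 1ℤ - o) * (+ 2 * k + + 3 + o)) * ((+ 2 * (1ℤ + k) - 1ℤ - o) * (+ 2 * (1ℤ + k) + 1ℤ - o)))
    step = solve-∀

  E-sq+4 : ∀ k o → E (suc k) (sq (o + + 4)) ≡ - (common k o * ((+ 2 * + k + + 3 + o) * (+ 2 * + k + + 5 + o)))
  E-sq+4 zero    o = base o
    where
    base : ∀ o → 1ℤ * ((+ 2 * + 0 + 1ℤ) * (+ 2 * + 0 + 1ℤ) - (o + + 4) * (o + + 4)) ≡ - (1ℤ * ((+ 2 * + 0 + + 3 + o) * (+ 2 * + 0 + + 5 + o)))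
    base = solve-∀
  E-sq+4 (suc k) o = trans (cong (_* (odd (+ suc k) * odd (+ suc k) - sq (o + + 4))) (E-sq+4 k o)) (step (+ k) o (common k o))
    where
    step : ∀ k o h → (- (h * ((+ 2 * k + + 3 + o) * (+ 2 * k + + 5 + o)))) * ((+ 2 * (1ℤ + k) + 1ℤ) * (+ 2 * (1ℤ + k) + 1ℤ) - (o + + 4) * (o + + 4))
      ≡ - (h * ((+ 2 * k - 1ℤ - o) * (+ 2 * k + + 3 + o)) * ((+ 2 * (1ℤ + k) + + 3 + o) * (+ 2 * (1ℤ + k) + + 5 + o)))
    step = solve-∀

  -- The summed WZ relation, free of division. If S denotes `N k` over `K k * R k`, then by
  -- `R-shift` the left side is a multiple of S((o + 4)²)/(o + 4) - S(o²)/o, and the right side is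
  -- the single boundary term left by telescoping.
  N-shift : ∀ k o → (+ 4 * + k - o) * N k (sq (o + + 4)) + (+ 4 * + k + + 4 + o) * N k (sq o)
    ≡ + 4 * odd (+ k) * O (suc k) * common k o
  N-shift zero    o = base o
    where
    base : ∀ o → (+ 4 * + 0 - o) * 1ℤ + (+ 4 * + 0 + + 4 + o) * 1ℤ ≡ + 4 * (+ 2 * + 0 + 1ℤ) * (1ℤ * (+ 2 * + 0 + 1ℤ)) * 1ℤ
    base = solve-∀
  N-shift (suc k) o = begin
    (+ 4 * + suc k - o) * (N k (sq (o + + 4)) * d (sq (o + + 4)) + c * E (suc k) (sq (o + + 4)))
      + (+ 4 * + suc k + + 4 + o) * (N k (sq o) * d (sq o) + c * E (suc k) (sq o))
      ≡⟨ cong₂ (λ e e′ → (+ 4 * + suc k - o) * (N k (sq (o + + 4)) * d (sq (o + + 4)) + c * e)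
                          + (+ 4 * + suc k + + 4 + o) * (N k (sq o) * d (sq o) + c * e′)) (E-sq+4 k o) (E-sq k o) ⟩
    -- 16 (k + 1)² - (o + 4)² = (4k - o)(4k + 8 + o) and 16 (k + 1)² - o² = (4k + 4 - o)(4k + 4 +
    -- o), so the two old sums share the factor (4k + 4 - o)(4k + 8 + o) and what remains is the
    -- relation for `k`.
    _ ≡⟨ regroup (+ k) o (common k o) (N k (sq (o + + 4))) (N k (sq o)) c ⟩
    + 2 * + suc k * ((+ 4 * + suc k - o) * (+ 4 * + k + + 8 + o))
       * ((+ 4 * + k - o) * N k (sq (o + + 4)) + (+ 4 * + k + + 4 + o) * N k (sq o)) - c * common k o * q (+ k)
      ≡⟨ cong (λ z → + 2 * + suc k * ((+ 4 * + suc k - o) * (+ 4 * + k + + 8 + o)) * z - c * common k o * q (+ k)) (N-shift k o) ⟩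
    _ ≡⟨ close (+ k) o (common k o) (O (suc k)) ⟩
    + 4 * odd (+ suc k) * O (suc (suc k)) * common (suc k) o ∎
    where
    open ≡-Reasoning
    d : ℤ → ℤ
    d x = + 2 * + suc k * (+ 16 * (+ suc k * + suc k) - x)
    c : ℤ
    c = (+ 6 * + suc k + 1ℤ) * O (suc k)
    q : ℤ → ℤ
    q k = (+ 4 * (1ℤ + k) - o) * ((+ 2 * k + + 3 + o) * (+ 2 * k + + 5 + o))
        + (+ 4 * k + + 8 + o) * ((+ 2 * k - 1ℤ - o) * (+ 2 * k + 1ℤ - o))
    regroup : ∀ k o h n n′ c →
      (+ 4 * (1ℤ + k) - o) * (n * (+ 2 * (1ℤ + k) * (+ 16 * ((1ℤ + k) * (1ℤ + k)) - (o + + 4) * (o + + 4)))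
          + c * - (h * ((+ 2 * k + + 3 + o) * (+ 2 * k + + 5 + o))))
      + (+ 4 * (1ℤ + k) + + 4 + o) * (n′ * (+ 2 * (1ℤ + k) * (+ 16 * ((1ℤ + k) * (1ℤ + k)) - o * o))
          + c * - (h * ((+ 2 * k - 1ℤ - o) * (+ 2 * k + 1ℤ - o))))
      ≡ + 2 * (1ℤ + k) * ((+ 4 * (1ℤ + k) - o) * (+ 4 * k + + 8 + o)) * ((+ 4 * k - o) * n + (+ 4 * k + + 4 + o) * n′)
        - c * h * ((+ 4 * (1ℤ + k) - o) * ((+ 2 * k + + 3 + o) * (+ 2 * k + + 5 + o))
                   + (+ 4 * k + + 8 + o) * ((+ 2 * k - 1ℤ - o) * (+ 2 * k + 1ℤ - o)))
    regroup = solve-∀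
    close : ∀ k o h O →
      + 2 * (1ℤ + k) * ((+ 4 * (1ℤ + k) - o) * (+ 4 * k + + 8 + o)) * (+ 4 * (+ 2 * k + 1ℤ) * O * h)
        - (+ 6 * (1ℤ + k) + 1ℤ) * O * h * ((+ 4 * (1ℤ + k) - o) * ((+ 2 * k + + 3 + o) * (+ 2 * k + + 5 + o))
                   + (+ 4 * k + + 8 + o) * ((+ 2 * k - 1ℤ - o) * (+ 2 * k + 1ℤ - o)))
      ≡ + 4 * (+ 2 * (1ℤ + k) + 1ℤ) * (O * (+ 2 * (1ℤ + k) + 1ℤ)) * (h * ((+ 2 * k - 1ℤ - o) * (+ 2 * k + + 3 + o)))
    close = solve-∀

  -- `R k` at `o²` is the product of (4l - o)(4l + o). Adding 4 to `o` shifts l by one in each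
  -- family, so only the end factors survive in the quotient.
  R-shift : ∀ k o → (+ 4 * + k - o) * ((o + + 4) * R k (sq (o + + 4))) ≡ - ((+ 4 * + k + + 4 + o) * (o * R k (sq o)))
  R-shift zero    o = base o
    where
    base : ∀ o → (+ 4 * + 0 - o) * ((o + + 4) * 1ℤ) ≡ - ((+ 4 * + 0 + + 4 + o) * (o * 1ℤ))
    base = solve-∀
  R-shift (suc k) o = begin
    _ ≡⟨ regroup (+ k) o (R k (sq (o + + 4))) ⟩
    (+ 4 * + suc k - o) * (+ 4 * + k + + 8 + o) * ((+ 4 * + k - o) * ((o + + 4) * R k (sq (o + + 4))))
      ≡⟨ cong ((+ 4 * + suc k - o) * (+ 4 * + k + + 8 + o) *_) (R-shift k o) ⟩
    _ ≡⟨ close (+ k) o (R k (sq o)) ⟩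
    _ ∎
    where
    open ≡-Reasoning
    regroup : ∀ k o r → (+ 4 * (1ℤ + k) - o) * ((o + + 4) * (r * (+ 16 * ((1ℤ + k) * (1ℤ + k)) - (o + + 4) * (o + + 4))))
      ≡ (+ 4 * (1ℤ + k) - o) * (+ 4 * k + + 8 + o) * ((+ 4 * k - o) * ((o + + 4) * r))
    regroup = solve-∀
    close : ∀ k o r → (+ 4 * (1ℤ + k) - o) * (+ 4 * k + + 8 + o) * - ((+ 4 * k + + 4 + o) * (o * r))
      ≡ - ((+ 4 * (1ℤ + k) + + 4 + o) * (o * (r * (+ 16 * ((1ℤ + k) * (1ℤ + k)) - o * o))))
    close = solve-∀

  -- Values at the odd squares.

  sgn : ℕ → ℤ
  sgn zero    = 1ℤ
  sgn (suc n) = - sgn n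

  odd⁻ : ℤ → ℤ
  odd⁻ n = + 2 * n - 1ℤ

  odd⁻-suc : ∀ n → odd⁻ (1ℤ + n) ≡ odd n
  odd⁻-suc = lemma
    where
    lemma : ∀ n → + 2 * (1ℤ + n) - 1ℤ ≡ + 2 * n + 1ℤ
    lemma = solve-∀

  odd⁻+4 : ∀ n → odd⁻ n + + 4 ≡ odd (1ℤ + n)
  odd⁻+4 = lemma
    where
    lemma : ∀ n → + 2 * n - 1ℤ + + 4 ≡ + 2 * (1ℤ + n) + 1ℤ
    lemma = solve-∀

  ≡0⇒*≡0 : ∀ {a} b → a ≡ 0ℤ → a * b ≡ 0ℤ
  ≡0⇒*≡0 b a≡0 = cong (_* b) a≡0

  -- The factor with index i contains 2i - 1 - o. This kills the right side of `N-shift` at o = 2i -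
  -- 1.
  common-root : ∀ {i} k → i < k → common k (odd⁻ (+ i)) ≡ 0ℤ
  common-root {i} (suc k) i<1+k with ℕ.m≤n⇒m<n∨m≡n (ℕ.≤-pred i<1+k)
  ... | inj₁ i<k  = ≡0⇒*≡0 ((+ 2 * + k - 1ℤ - odd⁻ (+ i)) * (+ 2 * + k + + 3 + odd⁻ (+ i))) (common-root k i<k)
  ... | inj₂ refl = lemma (+ k) (common k (odd⁻ (+ k)))
    where
    lemma : ∀ k h → h * ((+ 2 * k - 1ℤ - (+ 2 * k - 1ℤ)) * (+ 2 * k + + 3 + (+ 2 * k - 1ℤ))) ≡ 0ℤ
    lemma = solve-∀

  -- Stated for any `f` because it serves both for `N m` and for `N m` divided by p. The step goes
  -- from o = 2i - 1 to o + 4 = 2i + 3, so the first one starts at o = -1.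
  ShiftRelation : ℕ → (ℤ → ℤ) → Set
  ShiftRelation m f = ∀ i → i < m →
    (+ 4 * + m - odd⁻ (+ i)) * f (sq (odd (+ suc i))) + (+ 4 * + m + + 4 + odd⁻ (+ i)) * f (sq (odd⁻ (+ i))) ≡ 0ℤ

  N-shiftRelation : ∀ m → ShiftRelation m (N m)
  N-shiftRelation m i i<m = begin
    _ ≡⟨ cong (λ o → (+ 4 * + m - odd⁻ (+ i)) * N m (sq o) + (+ 4 * + m + + 4 + odd⁻ (+ i)) * N m (sq (odd⁻ (+ i)))) (odd⁻+4 (+ i)) ⟨
    _ ≡⟨ N-shift m (odd⁻ (+ i)) ⟩
    + 4 * odd (+ m) * O (suc m) * common m (odd⁻ (+ i)) ≡⟨ cong (+ 4 * odd (+ m) * O (suc m) *_) (common-root m i<m) ⟩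
    + 4 * odd (+ m) * O (suc m) * 0ℤ ≡⟨ *-zeroʳ (+ 4 * odd (+ m) * O (suc m)) ⟩
    0ℤ ∎
    where open ≡-Reasoning

  -- The factor with index 0 is 1 - x. Hence at x = 1 the deformed sum reduces to its first term 1,
  -- which gives `N-one`.
  E-one : ∀ k → E (suc k) 1ℤ ≡ 0ℤ
  E-one zero    = refl
  E-one (suc k) = ≡0⇒*≡0 (odd (+ suc k) * odd (+ suc k) - 1ℤ) (E-one k)

  N-one : ∀ k → N k 1ℤ ≡ K k * R k 1ℤ
  N-one zero    = refl
  N-one (suc k) = trans (cong₂ (λ n e → n * (+ 2 * + suc k * (+ 16 * (+ suc k * + suc k) - 1ℤ)) + (+ 6 * + suc k + 1ℤ) * O (suc k) * e) (N-one k) (E-one k))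
                        (lemma (+ suc k) (K k) (R k 1ℤ) ((+ 6 * + suc k + 1ℤ) * O (suc k)))
    where
    lemma : ∀ k K R c → K * R * (+ 2 * k * (+ 16 * (k * k) - 1ℤ)) + c * 0ℤ ≡ K * (+ 2 * k) * (R * (+ 16 * (k * k) - 1ℤ))
    lemma = solve-∀

  coefficient≢0 : ∀ {m i} → i < m → + 4 * + m - odd⁻ (+ i) ≢ 0ℤ
  coefficient≢0 {m} {i} i<m eq = 0≢pos (trans (sym eq) positive)
    where
    d = m ℕ.∸ suc i
    0≢pos : ∀ {n} → 0ℤ ≢ + suc n
    0≢pos ()
    lemma : ∀ i d → + 4 * (1ℤ + i + d) - (+ 2 * i - 1ℤ) ≡ + 5 + (+ 2 * i + + 4 * d)
    lemma = solve-∀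
    positive : + 4 * + m - odd⁻ (+ i) ≡ + (5 ℕ.+ (2 ℕ.* i ℕ.+ 4 ℕ.* d))
    positive = begin
      + 4 * + m - odd⁻ (+ i)           ≡⟨ cong (λ m → + 4 * + m - odd⁻ (+ i)) (ℕ.m+[n∸m]≡n i<m) ⟨
      + 4 * (+ (suc i ℕ.+ d)) - odd⁻ (+ i) ≡⟨ lemma (+ i) (+ d) ⟩
      + 5 + (+ 2 * + i + + 4 * + d)    ≡⟨ cong₂ (λ a b → + 5 + (a + b)) (pos-* 2 i) (pos-* 4 d) ⟨
      + (5 ℕ.+ (2 ℕ.* i ℕ.+ 4 ℕ.* d)) ∎
      where open ≡-Reasoning

  -- The relation steps from o to o + 4; since (-1)² = 1², both residues of j mod 2 start from N-one.
  N-odd-square : ∀ m j → j ≤ m →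
    N m (sq (odd⁻ (+ j))) ≡ - sgn j * (K m * (odd⁻ (+ j) * R m (sq (odd⁻ (+ j))))) ×
    N m (sq (odd (+ j))) ≡ sgn j * (K m * (odd (+ j) * R m (sq (odd (+ j)))))
  N-odd-square m zero _ = trans (N-one m) (lemma⁻ (K m) (R m 1ℤ)) , trans (N-one m) (lemma (K m) (R m 1ℤ))
    where
    lemma⁻ : ∀ K R → K * R ≡ - 1ℤ * (K * (- 1ℤ * R))
    lemma⁻ = solve-∀
    lemma : ∀ K R → K * R ≡ 1ℤ * (K * (1ℤ * R))
    lemma = solve-∀
  N-odd-square m (suc j) j<m with N-odd-square m j (ℕ.<⇒≤ j<m)
  ... | prev⁻ , prev = fst , *-cancelˡ-≡ c _ _ {{≢-nonZero (coefficient≢0 j<m)}} snd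
    where
    open ≡-Reasoning
    c = + 4 * + m - odd⁻ (+ j)
    o = odd⁻ (+ j)
    c′ = + 4 * + m + + 4 + o
    f = N m (sq (odd⁻ (+ j)))
    f′ = N m (sq (odd (+ suc j)))
    r = R m (sq (odd⁻ (+ j)))
    r′ = R m (sq (odd (+ suc j)))
    fst : N m (sq (odd⁻ (+ suc j))) ≡ - - sgn j * (K m * (odd⁻ (+ suc j) * R m (sq (odd⁻ (+ suc j)))))
    fst = subst₂ (λ s o → N m (sq o) ≡ s * (K m * (o * R m (sq o))))
                 (sym (neg-involutive (sgn j))) (sym (odd⁻-suc (+ j))) prev
    -- Up to sign, o R(o²) obeys the same step as `N m`; this trades `c′` for `c`, which can then be
    -- cancelled.
    R-step : c * (odd (+ suc j) * r′) ≡ - (c′ * (o * r))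
    R-step = trans (cong (λ o′ → c * (o′ * R m (sq o′))) (sym (odd⁻+4 (+ j)))) (R-shift m o)
    move : ∀ a b → a ≡ (a + b) - b
    move = solve-∀
    lemma₁ : ∀ c′ s K o r → 0ℤ - c′ * (- s * (K * (o * r))) ≡ - s * (K * (- (c′ * (o * r))))
    lemma₁ = solve-∀
    lemma₂ : ∀ s K c z → s * (K * (c * z)) ≡ c * (s * (K * z))
    lemma₂ = solve-∀
    snd : c * f′ ≡ c * (- sgn j * (K m * (odd (+ suc j) * r′)))
    snd = begin
      c * f′                                      ≡⟨ move (c * f′) (c′ * f) ⟩
      (c * f′ + c′ * f) - c′ * f                  ≡⟨ cong₂ (λ x y → x - c′ * y) (N-shiftRelation m j j<m) prev⁻ ⟩
      0ℤ - c′ * (- sgn j * (K m * (o * r)))       ≡⟨ lemma₁ c′ (sgn j) (K m) o r ⟩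
      - sgn j * (K m * (- (c′ * (o * r))))        ≡⟨ cong (λ z → - sgn j * (K m * z)) R-step ⟨
      - sgn j * (K m * (c * (odd (+ suc j) * r′))) ≡⟨ lemma₂ (- sgn j) (K m) c _ ⟩
      c * (- sgn j * (K m * (odd (+ suc j) * r′))) ∎

  -- Integer polynomials as coefficient vectors.

  eval : ∀ {n} → Vec ℤ n → ℤ → ℤ
  eval []      x = 0ℤ
  eval (c ∷ v) x = c + x * eval v x

  IsPoly : ℕ → (ℤ → ℤ) → Set
  IsPoly n f = ∃[ v ] (∀ x → f x ≡ eval {suc n} v x)

  one-isPoly : IsPoly 0 (λ _ → 1ℤ)
  one-isPoly = 1ℤ ∷ [] , λ x → sym (cong (λ z → 1ℤ + z) (*-zeroʳ x))

  eval-scale : ∀ {n} c (v : Vec ℤ n) x → eval (map (c *_) v) x ≡ c * eval v x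
  eval-scale c []      x = sym (*-zeroʳ c)
  eval-scale c (a ∷ v) x = trans (cong (λ z → c * a + x * z) (eval-scale c v x)) (lemma c a x (eval v x))
    where
    lemma : ∀ c a x e → c * a + x * (c * e) ≡ c * (a + x * e)
    lemma = solve-∀

  _⊕_ : ∀ {n} → Vec ℤ n → Vec ℤ n → Vec ℤ n
  []      ⊕ []      = []
  (a ∷ u) ⊕ (b ∷ v) = (a + b) ∷ (u ⊕ v)

  eval-⊕ : ∀ {n} (u v : Vec ℤ n) x → eval (u ⊕ v) x ≡ eval u x + eval v x
  eval-⊕ []      []      x = refl
  eval-⊕ (a ∷ u) (b ∷ v) x = trans (cong (λ z → a + b + x * z) (eval-⊕ u v x)) (lemma a b x (eval u x) (eval v x))
    where
    lemma : ∀ a b x u v → a + b + x * (u + v) ≡ a + x * u + (b + x * v)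
    lemma = solve-∀

  -- The coefficients of r + (a - X) v.
  mulLinear : ∀ {n} → ℤ → ℤ → Vec ℤ n → Vec ℤ (suc n)
  mulLinear a r []      = r ∷ []
  mulLinear a r (c ∷ v) = (r + a * c) ∷ mulLinear a (- c) v

  eval-mulLinear : ∀ {n} a r (v : Vec ℤ n) x → eval (mulLinear a r v) x ≡ r + eval v x * (a - x)
  eval-mulLinear a r []      x = cong (λ z → r + z) (*-zeroʳ x)
  eval-mulLinear a r (c ∷ v) x = trans (cong (λ z → r + a * c + x * z) (eval-mulLinear a (- c) v x)) (lemma a r c x (eval v x))
    where
    lemma : ∀ a r c x e → r + a * c + x * (- c + e * (a - x)) ≡ r + (c + x * e) * (a - x)
    lemma = solve-∀

  isPoly-mulLinear : ∀ {n f} a → IsPoly n f → IsPoly (suc n) (λ x → f x * (a - x))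
  isPoly-mulLinear a (v , f≡v) = mulLinear a 0ℤ v , λ x →
    trans (cong (_* (a - x)) (f≡v x)) (trans (sym (+-identityˡ _)) (sym (eval-mulLinear a 0ℤ v x)))

  isPoly-scale : ∀ {n f} c → IsPoly n f → IsPoly n (λ x → c * f x)
  isPoly-scale c (v , f≡v) = map (c *_) v , λ x → trans (cong (c *_) (f≡v x)) (sym (eval-scale c v x))

  isPoly-+ : ∀ {n f g} → IsPoly n f → IsPoly n g → IsPoly n (λ x → f x + g x)
  isPoly-+ (u , f≡u) (v , g≡v) = u ⊕ v , λ x → trans (cong₂ _+_ (f≡u x) (g≡v x)) (sym (eval-⊕ u v x))

  isPoly-cong : ∀ {n f g} → (∀ x → g x ≡ f x) → IsPoly n f → IsPoly n g
  isPoly-cong g≡f (v , f≡v) = v , λ x → trans (g≡f x) (f≡v x)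

  E-isPoly : ∀ k → IsPoly k (E k)
  E-isPoly zero    = one-isPoly
  E-isPoly (suc k) = isPoly-mulLinear (odd (+ k) * odd (+ k)) (E-isPoly k)

  R-isPoly : ∀ k → IsPoly k (R k)
  R-isPoly zero    = one-isPoly
  R-isPoly (suc k) = isPoly-mulLinear (+ 16 * (+ suc k * + suc k)) (R-isPoly k)

  N-isPoly : ∀ k → IsPoly k (N k)
  N-isPoly zero    = one-isPoly
  N-isPoly (suc k) = isPoly-+
    (isPoly-cong (λ x → lemma (N k x) (+ 2 * + suc k) (+ 16 * (+ suc k * + suc k) - x))
                 (isPoly-scale (+ 2 * + suc k) (isPoly-mulLinear (+ 16 * (+ suc k * + suc k)) (N-isPoly k))))
    (isPoly-scale ((+ 6 * + suc k + 1ℤ) * O (suc k)) (E-isPoly (suc k)))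
    where
    lemma : ∀ n c l → n * (c * l) ≡ c * (n * l)
    lemma = solve-∀

  -- Synthetic division: the coefficients of (v(X) - v(w)) / (X - w).
  quot : ∀ {n} → Vec ℤ (suc n) → ℤ → Vec ℤ n
  quot {zero}  _       w = []
  quot {suc n} (c ∷ v) w = eval v w ∷ quot v w

  eval-quot : ∀ {n} (v : Vec ℤ (suc n)) x w → eval v x - eval v w ≡ (x - w) * eval (quot v w) x
  eval-quot {zero}  (c ∷ []) x w = lemma c x w
    where
    lemma : ∀ c x w → c + x * 0ℤ - (c + w * 0ℤ) ≡ (x - w) * 0ℤ
    lemma = solve-∀
  eval-quot {suc n} (c ∷ v) x w = begin
    c + x * eval v x - (c + w * eval v w)               ≡⟨ lemma₁ c x w (eval v x) (eval v w) ⟩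
    (x - w) * eval v w + x * (eval v x - eval v w)      ≡⟨ cong (λ z → (x - w) * eval v w + x * z) (eval-quot v x w) ⟩
    (x - w) * eval v w + x * ((x - w) * eval (quot v w) x) ≡⟨ lemma₂ x (x - w) (eval v w) _ ⟩
    (x - w) * (eval v w + x * eval (quot v w) x)        ∎
    where
    open ≡-Reasoning
    lemma₁ : ∀ c x w a b → c + x * a - (c + w * b) ≡ (x - w) * b + x * (a - b)
    lemma₁ = solve-∀
    lemma₂ : ∀ x d b q → d * b + x * (d * q) ≡ d * (b + x * q)
    lemma₂ = solve-∀

  -- The coefficients of v(4X) - 4ⁿ v(X), whose terms of degree n cancel.
  dilate : ∀ {n} → Vec ℤ (suc n) → Vec ℤ n
  dilate {zero}  _       = []
  dilate {suc n} (c ∷ v) = c * (1ℤ - (+ 4) ^ suc n) ∷ map (+ 4 *_) (dilate v)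

  eval-dilate : ∀ {n} (v : Vec ℤ (suc n)) x → eval (dilate v) x ≡ eval v (+ 4 * x) - (+ 4) ^ n * eval v x
  eval-dilate {zero}  (c ∷ []) x = lemma c x
    where
    lemma : ∀ c x → 0ℤ ≡ c + + 4 * x * 0ℤ - 1ℤ * (c + x * 0ℤ)
    lemma = solve-∀
  eval-dilate {suc n} (c ∷ v) x = begin
    c * (1ℤ - (+ 4) ^ suc n) + x * eval (map (+ 4 *_) (dilate v)) x
      ≡⟨ cong (λ z → c * (1ℤ - (+ 4) ^ suc n) + x * z) (trans (eval-scale (+ 4) (dilate v) x) (cong (+ 4 *_) (eval-dilate v x))) ⟩
    c * (1ℤ - (+ 4) ^ suc n) + x * (+ 4 * (eval v (+ 4 * x) - (+ 4) ^ n * eval v x))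
      ≡⟨ lemma c x ((+ 4) ^ n) (eval v (+ 4 * x)) (eval v x) ⟩
    c + + 4 * x * eval v (+ 4 * x) - (+ 4) ^ suc n * (c + x * eval v x) ∎
    where
    open ≡-Reasoning
    lemma : ∀ c x q a b → c * (1ℤ - + 4 * q) + x * (+ 4 * (a - q * b)) ≡ c + + 4 * x * a - + 4 * q * (c + x * b)
    lemma = solve-∀

  -- Polynomials modulo a prime.

  module ModPrime {p : ℕ} (p-prime : Prime p) where

    P : ℤ
    P = + p

    ∣*⇒∣ : ∀ a b → P ∣ a * b → ¬ P ∣ a → P ∣ b
    ∣*⇒∣ a b p∣ab p∤a with euclidsLemma ℤ.∣ a ∣ ℤ.∣ b ∣ p-prime (subst (p ℕ.∣_) (abs-* a b) (∣⇒∣ᵤ p∣ab))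
    ... | inj₁ p∣a = contradiction (∣ᵤ⇒∣ p∣a) p∤a
    ... | inj₂ p∣b = ∣ᵤ⇒∣ p∣b

    ∤-* : ∀ {a b} → ¬ P ∣ a → ¬ P ∣ b → ¬ P ∣ a * b
    ∤-* {a} {b} p∤a p∤b p∣ab = p∤b (∣*⇒∣ a b p∣ab p∤a)

    ∤-small : ∀ {n} → suc n < p → ¬ P ∣ + suc n
    ∤-small n<p p∣n = ℕ.>⇒∤ n<p (∣⇒∣ᵤ p∣n)

    -- The entries of `quot v w` are the values at `w` of the proper tails of `v`, and each
    -- coefficient is the value of its own tail minus `w` times the value of the next.
    quot-coefficients : ∀ {n} (v : Vec ℤ (suc n)) w → P ∣ eval v w → All (P ∣_) (quot v w) → All (P ∣_) v
    quot-coefficients {zero}  (c ∷ []) w p∣v [] = subst (P ∣_) (trans (cong (λ z → c + z) (*-zeroʳ w)) (+-identityʳ c)) p∣v ∷ []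
    quot-coefficients {suc n} (c ∷ v) w p∣v (p∣v′ ∷ ps) =
      ∣m+n∣n⇒∣m p∣v (∣n⇒∣m*n w p∣v′) ∷ quot-coefficients v w p∣v′ ps

    -- Lagrange's bound on the number of roots. Dividing by X minus the last point leaves a quotient
    -- that has the other points as roots, since p does not divide the differences of points.
    roots⇒coefficients : ∀ {n} (v : Vec ℤ n) (w : ℕ → ℤ) →
      (∀ i j → i < j → j < n → ¬ P ∣ w i - w j) → (∀ i → i < n → P ∣ eval v (w i)) → All (P ∣_) v
    roots⇒coefficients {zero}  []  w distinct root = []
    roots⇒coefficients {suc n} v w distinct root = quot-coefficients v (w n) (root n ℕ.≤-refl)
      (roots⇒coefficients (quot v (w n)) w (λ i j i<j j<n → distinct i j i<j (ℕ.m<n⇒m<1+n j<n)) λ i i<n →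
        ∣*⇒∣ (w i - w n) (eval (quot v (w n)) (w i))
          (subst (P ∣_) (eval-quot v (w i) (w n)) (∣m∣n⇒∣m-n (root i (ℕ.m<n⇒m<1+n i<n)) (root n ℕ.≤-refl)))
          (distinct i n i<n ℕ.≤-refl))

    divideCoefficients : ∀ {n} {v : Vec ℤ n} → All (P ∣_) v → ∃[ u ] v ≡ map (P *_) u
    divideCoefficients [] = [] , refl
    divideCoefficients (divides q eq ∷ ps) with divideCoefficients ps
    ... | u , refl = q ∷ u , cong (_∷ _) (trans eq (*-comm q P))

  odd-pos : ∀ n → odd (+ n) ≡ + suc (2 ℕ.* n)
  odd-pos n = trans (cong (_+ 1ℤ) (sym (pos-* 2 n))) (cong +_ (ℕ.+-comm (2 ℕ.* n) 1))

  factor∣R : ∀ {i} k x → i < k → (+ 16 * (+ suc i * + suc i) - x) ∣ R k x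
  factor∣R {i} (suc k) x i<1+k with ℕ.m≤n⇒m<n∨m≡n (ℕ.≤-pred i<1+k)
  ... | inj₁ i<k  = ∣m⇒∣m*n (+ 16 * (+ suc k * + suc k) - x) (factor∣R k x i<k)
  ... | inj₂ refl = ∣n⇒∣m*n (R k x) ∣-refl

  -- The roots of `R m` are `quad i` for i < m, that is 16 l² with l = i + 1.
  quad : ℕ → ℤ
  quad i = + 16 * (+ suc i * + suc i)

  -- The polynomial u(X) - u(y). It has the same non-constant coefficients as `u`.
  subtractValue : ∀ {n} → ℤ → Vec ℤ (suc n) → Vec ℤ (suc n)
  subtractValue y u@(c ∷ cs) = (c - eval u y) ∷ cs

  eval-subtractValue : ∀ {n} y (u : Vec ℤ (suc n)) x → eval (subtractValue y u) x ≡ eval u x - eval u y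
  eval-subtractValue y u@(c ∷ cs) x = lemma c (eval u y) (x * eval cs x)
    where
    lemma : ∀ a b c → a - b + c ≡ a + c - b
    lemma = solve-∀

  -- Congruences for p = 2m + 1.

  module Congruence {p m : ℕ} (p-prime : Prime p) (p≡1+2m : p ≡ suc (2 ℕ.* m)) (2≤m : 2 ≤ m) where

    open ModPrime p-prime

    P≢0 : P ≢ 0ℤ
    P≢0 P≡0 with () ← trans (cong +_ (sym p≡1+2m)) P≡0

    P≡odd : P ≡ odd (+ m)
    P≡odd = trans (cong +_ p≡1+2m) (sym (odd-pos m))

    ≤2m⇒∤ : ∀ {n} → suc n ≤ 2 ℕ.* m → ¬ P ∣ + suc n
    ≤2m⇒∤ n<2m = ∤-small (subst (suc _ <_) (sym p≡1+2m) (s≤s n<2m))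

    4≤2m : 4 ≤ 2 ℕ.* m
    4≤2m = ℕ.*-monoʳ-≤ 2 2≤m

    2∤ : ¬ P ∣ + 2
    2∤ = ≤2m⇒∤ (ℕ.≤-trans (s≤s (s≤s z≤n)) 4≤2m)

    3∤ : ¬ P ∣ + 3
    3∤ = ≤2m⇒∤ (ℕ.≤-trans (s≤s (s≤s (s≤s z≤n))) 4≤2m)

    16∤ : ¬ P ∣ + 16
    16∤ = ∤-* {+ 4} {+ 4} (∤-* {+ 2} {+ 2} 2∤ 2∤) (∤-* {+ 2} {+ 2} 2∤ 2∤)

    odd∤ : ∀ {i} → i < m → ¬ P ∣ odd (+ i)
    odd∤ {i} i<m p∣ = ≤2m⇒∤ (ℕ.*-monoʳ-< 2 i<m) (subst (P ∣_) (odd-pos i) p∣)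

    suc∤ : ∀ {i} → i < m → ¬ P ∣ + suc i
    suc∤ i<m = ≤2m⇒∤ (ℕ.≤-trans i<m (ℕ.m≤m+n m _))

    i+j<2m : ∀ {i j} → i < j → j ≤ m → suc (i ℕ.+ j) ≤ 2 ℕ.* m
    i+j<2m {i} {j} i<j j≤m = subst (suc (i ℕ.+ j) ≤_) (cong (m ℕ.+_) (sym (ℕ.+-identityʳ m)))
      (ℕ.+-mono-≤ (ℕ.≤-trans i<j j≤m) j≤m)

    difference∤ : ∀ {i j} → i < j → j ≤ m → ¬ P ∣ + i - + j
    difference∤ {i} {j} i<j j≤m p∣ = ≤2m⇒∤ (ℕ.≤-trans bound (ℕ.≤-trans j≤m (ℕ.m≤m+n m _))) (subst (P ∣_) eq (∣m⇒∣-m p∣))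
      where
      d = j ℕ.∸ suc i
      bound : suc d ≤ j
      bound = subst (suc d ≤_) (ℕ.m+[n∸m]≡n i<j) (s≤s (ℕ.m≤n+m d i))
      lemma : ∀ i d → - (i - (1ℤ + i + d)) ≡ 1ℤ + d
      lemma = solve-∀
      eq : - (+ i - + j) ≡ + suc d
      eq = trans (cong (λ j → - (+ i - + j)) (sym (ℕ.m+[n∸m]≡n i<j))) (lemma (+ i) (+ d))

    -- The difference is 4 (i - j)(i + j + 1), and i < j ≤ m puts both j - i and i + j + 1 between 1
    -- and 2m.
    odd-squares-distinct : ∀ i j → i < j → j < suc m → ¬ P ∣ sq (odd (+ i)) - sq (odd (+ j))
    odd-squares-distinct i j i<j (s≤s j≤m) p∣ =
      ∤-* {+ 2 * + 2} (∤-* {+ 2} {+ 2} 2∤ 2∤) (∤-* {+ i - + j} {+ suc (i ℕ.+ j)} (difference∤ i<j j≤m) (≤2m⇒∤ (i+j<2m i<j j≤m)))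
        (subst (P ∣_) (lemma (+ i) (+ j)) p∣)
      where
      lemma : ∀ i j → (+ 2 * i + 1ℤ) * (+ 2 * i + 1ℤ) - (+ 2 * j + 1ℤ) * (+ 2 * j + 1ℤ) ≡ + 2 * + 2 * ((i - j) * (1ℤ + (i + j)))
      lemma = solve-∀

    quad-distinct : ∀ i j → i < j → j < m → ¬ P ∣ quad i - quad j
    quad-distinct i j i<j j<m p∣ =
      ∤-* {+ 16} 16∤ (∤-* {+ i - + j} {+ suc (suc i ℕ.+ j)} (difference∤ i<j (ℕ.<⇒≤ j<m))
                       (≤2m⇒∤ (subst (_≤ 2 ℕ.* m) (ℕ.+-suc (suc i) j) (ℕ.<⇒≤ (i+j<2m (s≤s i<j) j<m)))))
        (subst (P ∣_) (lemma (+ i) (+ j)) p∣)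
      where
      lemma : ∀ i j → + 16 * ((1ℤ + i) * (1ℤ + i)) - + 16 * ((1ℤ + j) * (1ℤ + j)) ≡ + 16 * ((i - j) * (1ℤ + (1ℤ + i + j)))
      lemma = solve-∀

    -- Since 2m ≡ -1 mod p, the two coefficients reduce to -(2j + 1) and 2j + 1, and p does not
    -- divide 2j + 1 for j < m. So each step preserves `f` mod p, and both chains of steps start at
    -- (-1)² = 1².
    shift⇒constant : ∀ f → ShiftRelation m f → ∀ j → j ≤ m →
      P ∣ f (sq (odd⁻ (+ j))) - f 1ℤ × P ∣ f (sq (odd (+ j))) - f 1ℤ
    shift⇒constant f shift zero    _   = P∣0 , P∣0
      where
      P∣0 : P ∣ f 1ℤ - f 1ℤ
      P∣0 = divides 0ℤ (+-inverseʳ (f 1ℤ))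
    shift⇒constant f shift (suc j) j<m with shift⇒constant f shift j (ℕ.<⇒≤ j<m)
    ... | prev⁻ , prev = subst (λ o → P ∣ f (sq o) - f 1ℤ) (sym (odd⁻-suc (+ j))) prev ,
                         subst (P ∣_) (telescope a b (f 1ℤ)) (∣m∣n⇒∣m+n step prev⁻)
      where
      open ≡-Reasoning
      a = f (sq (odd (+ suc j)))
      b = f (sq (odd⁻ (+ j)))
      telescope : ∀ a b c → a - b + (b - c) ≡ a - c
      telescope = solve-∀
      lemma : ∀ m j a b → (+ 2 * j + 1ℤ) * (a - b)
        ≡ + 2 * (a + b) * (+ 2 * m + 1ℤ) - ((+ 4 * m - (+ 2 * j - 1ℤ)) * a + (+ 4 * m + + 4 + (+ 2 * j - 1ℤ)) * b)
      lemma = solve-∀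
      step : P ∣ a - b
      step = ∣*⇒∣ (odd (+ j)) (a - b) (divides (+ 2 * (a + b)) (begin
        odd (+ j) * (a - b)  ≡⟨ lemma (+ m) (+ j) a b ⟩
        _                    ≡⟨ cong (λ z → + 2 * (a + b) * odd (+ m) - z) (shift j j<m) ⟩
        + 2 * (a + b) * odd (+ m) - 0ℤ ≡⟨ +-identityʳ _ ⟩
        + 2 * (a + b) * odd (+ m) ≡⟨ cong (+ 2 * (a + b) *_) (sym P≡odd) ⟩
        + 2 * (a + b) * P    ∎)) (odd∤ j<m)

    N-at-P² : N m (sq P) ≡ sgn m * (K m * (P * R m (sq P)))
    N-at-P² = subst (λ o → N m (sq o) ≡ sgn m * (K m * (o * R m (sq o)))) (sym P≡odd) (proj₂ (N-odd-square m m ℕ.≤-refl))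

    -- The last point, j = m, is P², where `N-at-P²` exhibits a factor p; constancy mod p carries it
    -- to the others.
    P∣N : ∀ j → j < suc m → P ∣ N m (sq (odd (+ j)))
    P∣N j (s≤s j≤m) = ∣m+n∣n⇒∣m {m = N m (sq (odd (+ j)))} (proj₂ (constant j j≤m)) (∣m⇒∣-m P∣N1)
      where
      constant = shift⇒constant (N m) (N-shiftRelation m)
      P∣N[P²] : P ∣ N m (sq P)
      P∣N[P²] = subst (P ∣_) (sym N-at-P²) (∣n⇒∣m*n (sgn m) (∣n⇒∣m*n (K m) (∣m⇒∣m*n (R m (sq P)) ∣-refl)))
      P∣N1 : P ∣ N m 1ℤ
      P∣N1 = subst (P ∣_) (neg-involutive (N m 1ℤ)) (∣m⇒∣-m
        (∣m+n∣m⇒∣n {m = N m (sq P)} (subst (λ o → P ∣ N m (sq o) - N m 1ℤ) (sym P≡odd) (proj₂ (constant m ℕ.≤-refl))) P∣N[P²]))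

    N/P : ∃[ u ] (∀ x → N m x ≡ P * eval {suc m} u x)
    N/P = proj₁ v/P , λ x → trans (proj₂ (N-isPoly m) x)
      (trans (cong (λ v → eval v x) (proj₂ v/P)) (eval-scale P (proj₁ v/P) x))
      where
      v = proj₁ (N-isPoly m)
      v/P = divideCoefficients (roots⇒coefficients v (λ i → sq (odd (+ i))) odd-squares-distinct
        (λ i i<1+m → subst (P ∣_) (proj₂ (N-isPoly m) (sq (odd (+ i)))) (P∣N i i<1+m)))

    -- The relation is linear in `f` and an exact equality of integers, not a congruence, so P can
    -- be cancelled.
    ShiftRelation-cancel : ∀ {f g : ℤ → ℤ} → (∀ x → f x ≡ P * g x) → ShiftRelation m f → ShiftRelation m g
    ShiftRelation-cancel {f} {g} f≡Pg shift i i<m = *-cancelˡ-≡ P (c * a + c′ * b) 0ℤ {{≢-nonZero P≢0}} (begin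
      P * (c * a + c′ * b)       ≡⟨ lemma P c c′ a b ⟩
      c * (P * a) + c′ * (P * b) ≡⟨ cong₂ (λ a b → c * a + c′ * b) (f≡Pg (sq (odd (+ suc i)))) (f≡Pg (sq (odd⁻ (+ i)))) ⟨
      c * f (sq (odd (+ suc i))) + c′ * f (sq (odd⁻ (+ i))) ≡⟨ shift i i<m ⟩
      0ℤ                         ≡⟨ *-zeroʳ P ⟨
      P * 0ℤ                     ∎)
      where
      open ≡-Reasoning
      c = + 4 * + m - odd⁻ (+ i)
      c′ = + 4 * + m + + 4 + odd⁻ (+ i)
      a = g (sq (odd (+ suc i)))
      b = g (sq (odd⁻ (+ i)))
      lemma : ∀ P c c′ a b → P * (c * a + c′ * b) ≡ c * (P * a) + c′ * (P * b)
      lemma = solve-∀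

    N-P²≡N-0 : ∃[ s ] N m (sq P) ≡ N m 0ℤ + sq (sq P) * s
    N-P²≡N-0 = conclude (proj₁ N/P) (proj₂ N/P)
      (roots⇒coefficients (subtractValue 1ℤ (proj₁ N/P)) (λ i → sq (odd (+ i))) odd-squares-distinct λ i i<1+m →
        subst (P ∣_) (sym (eval-subtractValue 1ℤ (proj₁ N/P) (sq (odd (+ i)))))
          (proj₂ (shift⇒constant (eval (proj₁ N/P)) (ShiftRelation-cancel (proj₂ N/P) (N-shiftRelation m)) i (ℕ.≤-pred i<1+m))))
      where
      conclude : ∀ {n} (u : Vec ℤ (suc n)) → (∀ x → N m x ≡ P * eval u x) → All (P ∣_) (subtractValue 1ℤ u) →
        ∃[ s ] N m (sq P) ≡ N m 0ℤ + sq (sq P) * s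
      conclude (c ∷ []) N≡ _ = 0ℤ , trans (N≡ (sq P)) (trans (lemma P c) (cong (_+ sq (sq P) * 0ℤ) (sym (N≡ 0ℤ))))
        where
        lemma : ∀ P c → P * (c + P * P * 0ℤ) ≡ P * (c + 0ℤ * 0ℤ) + P * P * (P * P) * 0ℤ
        lemma = solve-∀
      -- The second divisibility concerns `c₁` itself, as only the constant coefficient was changed.
      -- It raises P · P² · `c₁` to a multiple of P⁴; the later terms carry P⁵ already.
      conclude (c ∷ c₁ ∷ cs) N≡ (_ ∷ divides q c₁≡qP ∷ _) = q + P * e , (begin
        N m (sq P)                                ≡⟨ N≡ (sq P) ⟩
        P * (c + sq P * (c₁ + sq P * e))          ≡⟨ cong (λ c₁ → P * (c + sq P * (c₁ + sq P * e))) c₁≡qP ⟩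
        P * (c + sq P * (q * P + sq P * e))       ≡⟨ lemma P c q e ⟩
        P * (c + 0ℤ) + sq (sq P) * (q + P * e)    ≡⟨ cong (_+ sq (sq P) * (q + P * e)) (N≡ 0ℤ) ⟨
        N m 0ℤ + sq (sq P) * (q + P * e)          ∎)
        where
        open ≡-Reasoning
        e = eval cs (sq P)
        lemma : ∀ P c q e → P * (c + P * P * (q * P + P * P * e)) ≡ P * (c + 0ℤ) + P * P * (P * P) * (q + P * e)
        lemma = solve-∀

    -- 4 `quad l` is 16 (2l + 2)². If 2l + 2 ≤ m this is a root of `R m`; otherwise p - (2l + 2) is
    -- at most m and has the same square mod p.
    P∣R-4quad : ∀ l → l < m → P ∣ R m (+ 4 * quad l)
    P∣R-4quad l l<m with suc (l ℕ.+ l) ℕ.<? m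
    ... | yes 2l<m = ∣-trans (divides 0ℤ (lemma P (+ l))) (factor∣R m (+ 4 * quad l) 2l<m)
      where
      lemma : ∀ P l → + 16 * ((1ℤ + (1ℤ + (l + l))) * (1ℤ + (1ℤ + (l + l)))) - + 4 * (+ 16 * ((1ℤ + l) * (1ℤ + l))) ≡ 0ℤ * P
      lemma = solve-∀
    ... | no 2l≮m = ∣-trans (divides (+ 16 * (P - + 4 * + suc l)) eq) (factor∣R m (+ 4 * quad l) i<m)
      where
      d = m ℕ.∸ suc l
      -- i + 1 = 2d + 1 = p - 2 (l + 1), because p = 2 (1 + l + d) + 1.
      i = d ℕ.+ d
      m≡ : suc l ℕ.+ d ≡ m
      m≡ = ℕ.m+[n∸m]≡n l<m
      d≤l : d ≤ l
      d≤l = ℕ.+-cancelˡ-≤ (suc l) d l (subst (_≤ suc l ℕ.+ l) (sym m≡) (ℕ.≮⇒≥ 2l≮m))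
      i<m : i < m
      i<m = subst (i <_) m≡ (s≤s (ℕ.+-monoˡ-≤ d d≤l))
      lemma : ∀ l d → + 16 * ((1ℤ + (d + d)) * (1ℤ + (d + d))) - + 4 * (+ 16 * ((1ℤ + l) * (1ℤ + l)))
        ≡ + 16 * (+ 2 * (1ℤ + l + d) + 1ℤ - + 4 * (1ℤ + l)) * (+ 2 * (1ℤ + l + d) + 1ℤ)
      lemma = solve-∀
      eq : quad i - + 4 * quad l ≡ + 16 * (P - + 4 * + suc l) * P
      eq = trans (lemma (+ l) (+ d)) (cong (λ z → + 16 * (z - + 4 * + suc l) * z)
             (trans (cong (λ m → odd (+ m)) m≡) (sym P≡odd)))

    R0∤ : ∀ k → k ≤ m → ¬ P ∣ R k 0ℤ
    R0∤ zero    _   = ≤2m⇒∤ (ℕ.≤-trans (s≤s z≤n) 4≤2m)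
    R0∤ (suc k) k<m = ∤-* {R k 0ℤ} (R0∤ k (ℕ.<⇒≤ k<m))
      (subst (λ z → ¬ P ∣ z) (sym (+-identityʳ (quad k))) (∤-* {+ 16} 16∤ (∤-* {+ suc k} {+ suc k} (suc∤ k<m) (suc∤ k<m))))

    K∤ : ∀ k → k ≤ m → ¬ P ∣ K k
    K∤ zero    _   = ≤2m⇒∤ (ℕ.≤-trans (s≤s z≤n) 4≤2m)
    K∤ (suc k) k<m = ∤-* {K k} (K∤ k (ℕ.<⇒≤ k<m)) (∤-* {+ 2} {+ suc k} 2∤ (suc∤ k<m))

    R-P²≡R-0 : ∃[ t ] R m (sq P) ≡ R m 0ℤ + P * sq P * t
    R-P²≡R-0 = conclude 2≤m v R≡v (roots⇒coefficients (dilate v) quad quad-distinct root)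
      where
      v = proj₁ (R-isPoly m)
      R≡v = proj₂ (R-isPoly m)
      root : ∀ i → i < m → P ∣ eval (dilate v) (quad i)
      root i i<m = subst (P ∣_) (sym (eval-dilate v (quad i)))
        (∣m∣n⇒∣m-n (subst (P ∣_) (R≡v (+ 4 * quad i)) (P∣R-4quad i i<m))
          (∣n⇒∣m*n ((+ 4) ^ m) (subst (P ∣_) (R≡v (quad i))
            (∣-trans (divides 0ℤ (+-inverseʳ (quad i))) (factor∣R m (quad i) i<m)))))
      -- The bound 2 ≤ n ensures that `dilate v` has a linear coefficient.
      conclude : ∀ {n} → 2 ≤ n → (v : Vec ℤ (suc n)) → (∀ x → R m x ≡ eval v x) → All (P ∣_) (dilate v) →
        ∃[ t ] R m (sq P) ≡ R m 0ℤ + P * sq P * t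
      conclude {suc (suc n)} (s≤s (s≤s z≤n)) (c ∷ c₁ ∷ cs) R≡ (p∣₀ ∷ p∣₁ ∷ _) = finish c₁-divisible
        where
        open ≡-Reasoning
        four-power : P ∣ 1ℤ - (+ 4) ^ suc (suc n)
        four-power = ∣*⇒∣ c (1ℤ - (+ 4) ^ suc (suc n)) p∣₀
          (subst (λ z → ¬ P ∣ z) (trans (R≡ 0ℤ) (+-identityʳ c)) (R0∤ m ℕ.≤-refl))
        -- With q = 4^(n + 1), the linear coefficient of `dilate v` is 4 `c₁` (1 - q), while p
        -- divides `c₁` (1 - 4q) by `four-power`; the difference is 3 `c₁`.
        rearrange : ∀ c q → + 4 * (c * (1ℤ - q)) - c * (1ℤ - + 4 * q) ≡ + 3 * c
        rearrange = solve-∀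
        c₁-divisible : P ∣ c₁
        c₁-divisible = ∣*⇒∣ (+ 3) c₁ (subst (P ∣_) (rearrange c₁ ((+ 4) ^ suc n)) (∣m∣n⇒∣m-n p∣₁ (∣n⇒∣m*n c₁ four-power))) 3∤
        lemma : ∀ P c q e → c + P * P * (q * P + P * P * e) ≡ c + 0ℤ + P * (P * P) * (q + P * e)
        lemma = solve-∀
        finish : P ∣ c₁ → ∃[ t ] R m (sq P) ≡ R m 0ℤ + P * sq P * t
        finish (divides q c₁≡qP) = q + P * eval cs (sq P) , (begin
          R m (sq P)                                   ≡⟨ R≡ (sq P) ⟩
          c + sq P * (c₁ + sq P * eval cs (sq P))      ≡⟨ cong (λ c₁ → c + sq P * (c₁ + sq P * eval cs (sq P))) c₁≡qP ⟩
          c + sq P * (q * P + sq P * eval cs (sq P))   ≡⟨ lemma P c q (eval cs (sq P)) ⟩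
          c + 0ℤ + P * sq P * (q + P * eval cs (sq P)) ≡⟨ cong (_+ P * sq P * (q + P * eval cs (sq P))) (R≡ 0ℤ) ⟨
          R m 0ℤ + P * sq P * (q + P * eval cs (sq P)) ∎)

    -- The value of `N m` at P² carries an explicit factor P, so `R m` at P² is needed only mod P³.
    N-0-mod-P⁴ : ∃[ a ] N m 0ℤ - sgn m * P * (K m * R m 0ℤ) ≡ sq (sq P) * a
    N-0-mod-P⁴ = sgn m * K m * t - s , (begin
      N m 0ℤ - c                                  ≡⟨ move (N m 0ℤ) (sq (sq P) * s) c ⟩
      (N m 0ℤ + sq (sq P) * s) - sq (sq P) * s - c ≡⟨ cong (λ z → z - sq (sq P) * s - c) (trans (sym (proj₂ N-P²≡N-0)) N-at-P²) ⟩
      sgn m * (K m * (P * R m (sq P))) - sq (sq P) * s - c ≡⟨ cong (λ z → sgn m * (K m * (P * z)) - sq (sq P) * s - c) (proj₂ R-P²≡R-0) ⟩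
      sgn m * (K m * (P * (R m 0ℤ + P * sq P * t))) - sq (sq P) * s - c ≡⟨ lemma P (sgn m) (K m) (R m 0ℤ) s t ⟩
      sq (sq P) * (sgn m * K m * t - s)           ∎)
      where
      open ≡-Reasoning
      s = proj₁ N-P²≡N-0
      t = proj₁ R-P²≡R-0
      c = sgn m * P * (K m * R m 0ℤ)
      move : ∀ n s c → n - c ≡ (n + s) - s - c
      move = solve-∀
      lemma : ∀ P σ K R s t → σ * (K * (P * (R + P * (P * P) * t))) - P * P * (P * P) * s - σ * P * (K * R) ≡ P * P * (P * P) * (σ * K * t - s)
      lemma = solve-∀

-- Transfer to the rational sum.

module Rational where

  open Integral
  open import Data.Integer.Divisibility.Signed using (∣ᵤ⇒∣) renaming (_∣_ to _∣ℤ_)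
  import Data.Integer.Tactic.RingSolver as ℤ
  open import Data.Rational using (_+_; _*_; _-_; -_; _/_; 1ℚ; toℚᵘ)
  open import Data.Rational.Properties as ℚ using (toℚᵘ-fromℚᵘ; toℚᵘ-homo-+; toℚᵘ-homo-*; toℚᵘ-injective)
  open import Data.Rational.Solver using (module +-*-Solver)
  open import Data.Rational.Unnormalised as ℚᵘ using (mkℚᵘ; *≡*)
  import Data.Rational.Unnormalised.Properties as ℚᵘ
  open import Algebra.Properties.Group ℚ.+-0-group using (⁻¹-involutive)

  -- Checked on unnormalised fractions, where addition involves no reduction by a gcd.
  ℤ→ℚ-+ : ∀ a b → ℤ→ℚ (a ℤ.+ b) ≡ ℤ→ℚ a + ℤ→ℚ b
  ℤ→ℚ-+ a b = toℚᵘ-injective (begin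
    toℚᵘ (ℤ→ℚ (a ℤ.+ b))             ≈⟨ toℚᵘ-fromℚᵘ (mkℚᵘ (a ℤ.+ b) 0) ⟩
    mkℚᵘ (a ℤ.+ b) 0                  ≈⟨ *≡* (lemma a b) ⟩
    mkℚᵘ a 0 ℚᵘ.+ mkℚᵘ b 0            ≈⟨ ℚᵘ.+-cong (toℚᵘ-fromℚᵘ (mkℚᵘ a 0)) (toℚᵘ-fromℚᵘ (mkℚᵘ b 0)) ⟨
    toℚᵘ (ℤ→ℚ a) ℚᵘ.+ toℚᵘ (ℤ→ℚ b)    ≈⟨ toℚᵘ-homo-+ (ℤ→ℚ a) (ℤ→ℚ b) ⟨
    toℚᵘ (ℤ→ℚ a + ℤ→ℚ b)              ∎)
    where
    open import Relation.Binary.Reasoning.Setoid ℚᵘ.≃-setoid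
    lemma : ∀ a b → (a ℤ.+ b) ℤ.* + 1 ≡ (a ℤ.* + 1 ℤ.+ b ℤ.* + 1) ℤ.* + 1
    lemma = ℤ.solve-∀

  ℤ→ℚ-* : ∀ a b → ℤ→ℚ (a ℤ.* b) ≡ ℤ→ℚ a * ℤ→ℚ b
  ℤ→ℚ-* a b = toℚᵘ-injective (begin
    toℚᵘ (ℤ→ℚ (a ℤ.* b))             ≈⟨ toℚᵘ-fromℚᵘ (mkℚᵘ (a ℤ.* b) 0) ⟩
    mkℚᵘ (a ℤ.* b) 0                  ≈⟨ *≡* refl ⟩
    mkℚᵘ a 0 ℚᵘ.* mkℚᵘ b 0            ≈⟨ ℚᵘ.*-cong (toℚᵘ-fromℚᵘ (mkℚᵘ a 0)) (toℚᵘ-fromℚᵘ (mkℚᵘ b 0)) ⟨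
    toℚᵘ (ℤ→ℚ a) ℚᵘ.* toℚᵘ (ℤ→ℚ b)    ≈⟨ toℚᵘ-homo-* (ℤ→ℚ a) (ℤ→ℚ b) ⟨
    toℚᵘ (ℤ→ℚ a * ℤ→ℚ b)              ∎)
    where open import Relation.Binary.Reasoning.Setoid ℚᵘ.≃-setoid

  ℤ→ℚ-neg : ∀ a → ℤ→ℚ (ℤ.- a) ≡ - ℤ→ℚ a
  ℤ→ℚ-neg (+ zero)  = refl
  ℤ→ℚ-neg (+ suc n) = refl
  ℤ→ℚ-neg -[1+ n ]  = sym (⁻¹-involutive (ℤ→ℚ (+ suc n)))

  ℤ→ℚ-- : ∀ a b → ℤ→ℚ (a ℤ.- b) ≡ ℤ→ℚ a - ℤ→ℚ b
  ℤ→ℚ-- a b = trans (ℤ→ℚ-+ a (ℤ.- b)) (cong (λ z → ℤ→ℚ a + z) (ℤ→ℚ-neg b))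

  1/n*n≡1 : ∀ n .{{_ : ℕ.NonZero n}} → (+ 1 / n) * ℤ→ℚ (+ n) ≡ 1ℚ
  1/n*n≡1 n@(suc n-1) = toℚᵘ-injective (begin
    toℚᵘ ((+ 1 / n) * ℤ→ℚ (+ n))            ≈⟨ toℚᵘ-homo-* (+ 1 / n) (ℤ→ℚ (+ n)) ⟩
    toℚᵘ (+ 1 / n) ℚᵘ.* toℚᵘ (ℤ→ℚ (+ n))    ≈⟨ ℚᵘ.*-cong (toℚᵘ-fromℚᵘ (mkℚᵘ (+ 1) n-1)) (toℚᵘ-fromℚᵘ (mkℚᵘ (+ n) 0)) ⟩
    mkℚᵘ (+ 1) n-1 ℚᵘ.* mkℚᵘ (+ n) 0        ≈⟨ *≡* lemma ⟩
    mkℚᵘ (+ 1) 0                            ∎)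
    where
    open import Relation.Binary.Reasoning.Setoid ℚᵘ.≃-setoid
    lemma : + 1 ℤ.* + n ℤ.* + 1 ≡ + 1 ℤ.* + (n ℕ.* 1)
    lemma = trans (ℤ.*-identityʳ (+ 1 ℤ.* + n)) (cong (λ z → + 1 ℤ.* + z) (sym (ℕ.*-identityʳ n)))

  sign≡sgn : ∀ n → sign n ≡ ℤ→ℚ (sgn n)
  sign≡sgn zero    = refl
  sign≡sgn (suc n) = trans (cong -_ (sign≡sgn n)) (sym (ℤ→ℚ-neg (sgn n)))

  rising-half : ∀ k → rising half k * ℤ→ℚ (+ (2 ℕ.^ k)) ≡ ℤ→ℚ (O k)
  rising-half zero    = refl
  rising-half (suc k) = begin
    r * (half + ℤ→ℚ (+ k)) * ℤ→ℚ (+ (2 ℕ.* 2 ℕ.^ k))     ≡⟨ cong (r * (half + ℤ→ℚ (+ k)) *_) 2^suc ⟩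
    r * (half + ℤ→ℚ (+ k)) * (ℤ→ℚ (+ 2) * q)             ≡⟨ solve 5 (λ r h k t q → r :* (h :+ k) :* (t :* q) := r :* q :* (t :* k :+ h :* t)) refl r half (ℤ→ℚ (+ k)) (ℤ→ℚ (+ 2)) q ⟩
    r * q * (ℤ→ℚ (+ 2) * ℤ→ℚ (+ k) + ℤ→ℚ 1ℤ)             ≡⟨ cong₂ _*_ (rising-half k) odd≡ ⟩
    ℤ→ℚ (O k) * ℤ→ℚ (odd (+ k))                          ≡⟨ ℤ→ℚ-* (O k) (odd (+ k)) ⟨
    ℤ→ℚ (O k ℤ.* odd (+ k))                              ∎
    where
    open ≡-Reasoning
    open +-*-Solver
    r = rising half k
    q = ℤ→ℚ (+ (2 ℕ.^ k))
    2^suc : ℤ→ℚ (+ (2 ℕ.* 2 ℕ.^ k)) ≡ ℤ→ℚ (+ 2) * q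
    2^suc = trans (cong ℤ→ℚ (ℤ.pos-* 2 (2 ℕ.^ k))) (ℤ→ℚ-* (+ 2) (+ (2 ℕ.^ k)))
    odd≡ : ℤ→ℚ (+ 2) * ℤ→ℚ (+ k) + ℤ→ℚ 1ℤ ≡ ℤ→ℚ (odd (+ k))
    odd≡ = sym (trans (ℤ→ℚ-+ (+ 2 ℤ.* + k) 1ℤ) (cong (_+ ℤ→ℚ 1ℤ) (ℤ→ℚ-* (+ 2) (+ k))))

  K≡2^k*k! : ∀ k → K k ≡ + (2 ℕ.^ k) ℤ.* + (k !)
  K≡2^k*k! zero    = refl
  K≡2^k*k! (suc k) = begin
    K k ℤ.* (+ 2 ℤ.* + suc k)                                  ≡⟨ cong (ℤ._* (+ 2 ℤ.* + suc k)) (K≡2^k*k! k) ⟩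
    + (2 ℕ.^ k) ℤ.* + (k !) ℤ.* (+ 2 ℤ.* + suc k)              ≡⟨ lemma (+ (2 ℕ.^ k)) (+ (k !)) (+ 2) (+ suc k) ⟩
    (+ 2 ℤ.* + (2 ℕ.^ k)) ℤ.* (+ suc k ℤ.* + (k !))            ≡⟨ cong₂ ℤ._*_ (ℤ.pos-* 2 (2 ℕ.^ k)) (ℤ.pos-* (suc k) (k !)) ⟨
    + (2 ℕ.^ suc k) ℤ.* + (suc k !)                            ∎
    where
    open ≡-Reasoning
    lemma : ∀ a b c d → a ℤ.* b ℤ.* (c ℤ.* d) ≡ (c ℤ.* a) ℤ.* (d ℤ.* b)
    lemma = ℤ.solve-∀

  ratio-K : ∀ k → ratio k * ℤ→ℚ (K k) ≡ ℤ→ℚ (O k)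
  ratio-K k = begin
    r * i * ℤ→ℚ (K k)        ≡⟨ cong (λ z → r * i * z) (trans (cong ℤ→ℚ (K≡2^k*k! k)) (ℤ→ℚ-* (+ (2 ℕ.^ k)) (+ (k !)))) ⟩
    r * i * (q * f)          ≡⟨ solve 4 (λ r i q f → r :* i :* (q :* f) := r :* q :* (i :* f)) refl r i q f ⟩
    r * q * (i * f)          ≡⟨ cong₂ _*_ (rising-half k) (1/n*n≡1 (k !) {{k ℕ.!≢0}}) ⟩
    ℤ→ℚ (O k) * 1ℚ           ≡⟨ ℚ.*-identityʳ (ℤ→ℚ (O k)) ⟩
    ℤ→ℚ (O k)                ∎
    where
    open ≡-Reasoning
    open +-*-Solver
    r = rising half k
    i = _/_ (+ 1) (k !) {{k ℕ.!≢0}}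
    q = ℤ→ℚ (+ (2 ℕ.^ k))
    f = ℤ→ℚ (+ (k !))

  -- 16^k k!² = (2^k k!)² 4^k. Hence `K k * R k 0ℤ` is K³ 4^k, exactly what clears the cube and the
  -- power of 4 in `term k`.
  R-0 : ∀ k → R k 0ℤ ≡ K k ℤ.* K k ℤ.* + (4 ℕ.^ k)
  R-0 zero    = refl
  R-0 (suc k) = begin
    R k 0ℤ ℤ.* (+ 16 ℤ.* (+ suc k ℤ.* + suc k) ℤ.- 0ℤ)                ≡⟨ cong (ℤ._* (+ 16 ℤ.* (+ suc k ℤ.* + suc k) ℤ.- 0ℤ)) (R-0 k) ⟩
    K k ℤ.* K k ℤ.* q ℤ.* (+ 16 ℤ.* (+ suc k ℤ.* + suc k) ℤ.- 0ℤ)     ≡⟨ lemma (K k) q (+ suc k) ⟩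
    K (suc k) ℤ.* K (suc k) ℤ.* (+ 4 ℤ.* q)                           ≡⟨ cong (K (suc k) ℤ.* K (suc k) ℤ.*_) (ℤ.pos-* 4 (4 ℕ.^ k)) ⟨
    K (suc k) ℤ.* K (suc k) ℤ.* + (4 ℕ.^ suc k)                       ∎
    where
    open ≡-Reasoning
    q = + (4 ℕ.^ k)
    lemma : ∀ K q k → K ℤ.* K ℤ.* q ℤ.* (+ 16 ℤ.* (k ℤ.* k) ℤ.- 0ℤ) ≡ K ℤ.* (+ 2 ℤ.* k) ℤ.* (K ℤ.* (+ 2 ℤ.* k)) ℤ.* (+ 4 ℤ.* q)
    lemma = ℤ.solve-∀

  E-0 : ∀ k → E k 0ℤ ≡ O k ℤ.* O k
  E-0 zero    = refl
  E-0 (suc k) = trans (cong (ℤ._* (odd (+ k) ℤ.* odd (+ k) ℤ.- 0ℤ)) (E-0 k)) (lemma (O k) (odd (+ k)))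
    where
    lemma : ∀ O o → O ℤ.* O ℤ.* (o ℤ.* o ℤ.- 0ℤ) ≡ O ℤ.* o ℤ.* (O ℤ.* o)
    lemma = ℤ.solve-∀

  term-cleared : ∀ k → term k * ℤ→ℚ (K k ℤ.* R k 0ℤ) ≡ ℤ→ℚ ((+ 6 ℤ.* + k ℤ.+ 1ℤ) ℤ.* O k ℤ.* E k 0ℤ)
  term-cleared k = begin
    c * (s * s * s) * i * ℤ→ℚ (K k ℤ.* R k 0ℤ)            ≡⟨ cong (c * (s * s * s) * i *_) K*R ⟩
    c * (s * s * s) * i * (κ * (κ * κ * q))               ≡⟨ solve 5 (λ c s i κ q → c :* (s :* s :* s) :* i :* (κ :* (κ :* κ :* q)) := c :* (s :* κ) :* (s :* κ :* (s :* κ)) :* (i :* q)) refl c s i κ q ⟩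
    c * (s * κ) * (s * κ * (s * κ)) * (i * q)             ≡⟨ cong₂ (λ x y → c * x * (x * x) * y) (ratio-K k) (1/n*n≡1 (4 ℕ.^ k) {{ℕ.m^n≢0 4 k}}) ⟩
    c * ω * (ω * ω) * 1ℚ                                  ≡⟨ ℚ.*-identityʳ _ ⟩
    c * ω * (ω * ω)                                       ≡⟨ cong₂ (λ x y → x * ω * y) c≡ (trans (sym (ℤ→ℚ-* (O k) (O k))) (cong ℤ→ℚ (sym (E-0 k)))) ⟩
    ℤ→ℚ (+ 6 ℤ.* + k ℤ.+ 1ℤ) * ω * ℤ→ℚ (E k 0ℤ)           ≡⟨ cong (_* ℤ→ℚ (E k 0ℤ)) (ℤ→ℚ-* (+ 6 ℤ.* + k ℤ.+ 1ℤ) (O k)) ⟨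
    ℤ→ℚ ((+ 6 ℤ.* + k ℤ.+ 1ℤ) ℤ.* O k) * ℤ→ℚ (E k 0ℤ)     ≡⟨ ℤ→ℚ-* ((+ 6 ℤ.* + k ℤ.+ 1ℤ) ℤ.* O k) (E k 0ℤ) ⟨
    ℤ→ℚ ((+ 6 ℤ.* + k ℤ.+ 1ℤ) ℤ.* O k ℤ.* E k 0ℤ)         ∎
    where
    open ≡-Reasoning
    open +-*-Solver
    c = ℤ→ℚ (+ (6 ℕ.* k ℕ.+ 1))
    s = ratio k
    i = inv4^ k
    κ = ℤ→ℚ (K k)
    ω = ℤ→ℚ (O k)
    q = ℤ→ℚ (+ (4 ℕ.^ k))
    c≡ : c ≡ ℤ→ℚ (+ 6 ℤ.* + k ℤ.+ 1ℤ)
    c≡ = cong (λ z → ℤ→ℚ (z ℤ.+ 1ℤ)) (ℤ.pos-* 6 k)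
    K*R : ℤ→ℚ (K k ℤ.* R k 0ℤ) ≡ κ * (κ * κ * q)
    K*R = trans (cong (λ z → ℤ→ℚ (K k ℤ.* z)) (R-0 k)) (trans (ℤ→ℚ-* (K k) _) (cong (κ *_)
            (trans (ℤ→ℚ-* (K k ℤ.* K k) _) (cong (_* q) (ℤ→ℚ-* (K k) (K k))))))

  sum-cleared : ∀ k → sumTo k term * ℤ→ℚ (K k ℤ.* R k 0ℤ) ≡ ℤ→ℚ (N k 0ℤ)
  sum-cleared zero    = refl
  sum-cleared (suc k) = begin
    (sumTo k term + term (suc k)) * ℤ→ℚ d′                             ≡⟨ ℚ.*-distribʳ-+ (ℤ→ℚ d′) (sumTo k term) (term (suc k)) ⟩
    sumTo k term * ℤ→ℚ d′ + term (suc k) * ℤ→ℚ d′                      ≡⟨ cong₂ _+_ (cong (sumTo k term *_) (trans (cong ℤ→ℚ d′≡) (ℤ→ℚ-* d x))) (term-cleared (suc k)) ⟩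
    sumTo k term * (ℤ→ℚ d * ℤ→ℚ x) + ℤ→ℚ y                             ≡⟨ cong (_+ ℤ→ℚ y) (ℚ.*-assoc (sumTo k term) (ℤ→ℚ d) (ℤ→ℚ x)) ⟨
    sumTo k term * ℤ→ℚ d * ℤ→ℚ x + ℤ→ℚ y                               ≡⟨ cong (λ z → z * ℤ→ℚ x + ℤ→ℚ y) (sum-cleared k) ⟩
    ℤ→ℚ (N k 0ℤ) * ℤ→ℚ x + ℤ→ℚ y                                       ≡⟨ cong (_+ ℤ→ℚ y) (ℤ→ℚ-* (N k 0ℤ) x) ⟨
    ℤ→ℚ (N k 0ℤ ℤ.* x) + ℤ→ℚ y                                         ≡⟨ ℤ→ℚ-+ (N k 0ℤ ℤ.* x) y ⟨
    ℤ→ℚ (N k 0ℤ ℤ.* x ℤ.+ y)                                           ∎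
    where
    open ≡-Reasoning
    d = K k ℤ.* R k 0ℤ
    d′ = K (suc k) ℤ.* R (suc k) 0ℤ
    x = + 2 ℤ.* + suc k ℤ.* (+ 16 ℤ.* (+ suc k ℤ.* + suc k) ℤ.- 0ℤ)
    y = (+ 6 ℤ.* + suc k ℤ.+ 1ℤ) ℤ.* O (suc k) ℤ.* E (suc k) 0ℤ
    lemma : ∀ K R t u → K ℤ.* t ℤ.* (R ℤ.* u) ≡ K ℤ.* R ℤ.* (t ℤ.* u)
    lemma = ℤ.solve-∀
    d′≡ : d′ ≡ d ℤ.* x
    d′≡ = lemma (K k) (R k 0ℤ) (+ 2 ℤ.* + suc k) (+ 16 ℤ.* (+ suc k ℤ.* + suc k) ℤ.- 0ℤ)

  -- The congruence asks for a natural denominator; for negative `z` the sign passes to the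
  -- numerator.
  mod-intro : ∀ {A B p n} z a → ¬ (+ p ∣ℤ z) →
    (A - B) * ℤ→ℚ z ≡ ℤ→ℚ (+ (p ℕ.^ n)) * ℤ→ℚ a → A ≡ B [modℚ p ^ n ]
  mod-intro (+ b)    a p∤z eq = a , b , (λ p∣b → p∤z (∣ᵤ⇒∣ p∣b)) , eq
  mod-intro {A} {B} {p} {n} -[1+ b ] a p∤z eq = ℤ.- a , suc b , (λ p∣b → p∤z (∣ᵤ⇒∣ p∣b)) , (begin
    (A - B) * ℤ→ℚ (+ suc b)          ≡⟨ ⁻¹-involutive ((A - B) * ℤ→ℚ (+ suc b)) ⟨
    - - ((A - B) * ℤ→ℚ (+ suc b))    ≡⟨ cong -_ (ℚ.neg-distribʳ-* (A - B) (ℤ→ℚ (+ suc b))) ⟩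
    - ((A - B) * - ℤ→ℚ (+ suc b))    ≡⟨ cong -_ eq ⟩
    - (ℤ→ℚ (+ (p ℕ.^ n)) * ℤ→ℚ a)    ≡⟨ ℚ.neg-distribʳ-* (ℤ→ℚ (+ (p ℕ.^ n))) (ℤ→ℚ a) ⟩
    ℤ→ℚ (+ (p ℕ.^ n)) * - ℤ→ℚ a      ≡⟨ cong (ℤ→ℚ (+ (p ℕ.^ n)) *_) (ℤ→ℚ-neg a) ⟨
    ℤ→ℚ (+ (p ℕ.^ n)) * ℤ→ℚ (ℤ.- a)  ∎)
    where open ≡-Reasoning

  pos-^4 : ∀ p → + (p ℕ.^ 4) ≡ sq (sq (+ p))
  pos-^4 p = begin
    + (p ℕ.^ 4)                  ≡⟨ cong +_ (trans (ℕ.^-distribˡ-+-* p 2 2) (cong₂ ℕ._*_ p² p²)) ⟩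
    + ((p ℕ.* p) ℕ.* (p ℕ.* p))  ≡⟨ ℤ.pos-* (p ℕ.* p) (p ℕ.* p) ⟩
    sq (+ (p ℕ.* p))             ≡⟨ cong sq (ℤ.pos-* p p) ⟩
    sq (sq (+ p))                ∎
    where
    open ≡-Reasoning
    p² : p ℕ.^ 2 ≡ p ℕ.* p
    p² = cong (p ℕ.*_) (ℕ.*-identityʳ p)

  odd-prime : ∀ {p} → Prime p → 3 < p → p ≡ suc (2 ℕ.* ((p ℕ.∸ 1) ℕ./ 2))
  odd-prime {p} p-prime 3<p = trans p≡ (cong (λ z → suc (2 ℕ.* z)) (sym half≡))
    where
    open ≡-Reasoning
    h′ = p ℕ./ 2
    remainder : p ℕ.% 2 ≡ 1
    remainder with p ℕ.% 2 in eq | ℕ.m%n<n p 2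
    -- An even prime would be 2, against 3 < p.
    ... | 0           | _ with prime⇒irreducible p-prime (ℕ.m%n≡0⇒n∣m p 2 eq)
    ...   | inj₂ refl = contradiction 3<p (ℕ.≤⇒≯ (s≤s (s≤s z≤n)))
    remainder | 1           | _ = refl
    remainder | suc (suc _) | s≤s (s≤s ())
    p≡ : p ≡ suc (2 ℕ.* h′)
    p≡ = begin
      p                        ≡⟨ ℕ.m≡m%n+[m/n]*n p 2 ⟩
      p ℕ.% 2 ℕ.+ h′ ℕ.* 2     ≡⟨ cong₂ ℕ._+_ remainder (ℕ.*-comm h′ 2) ⟩
      suc (2 ℕ.* h′)           ∎
    half≡ : (p ℕ.∸ 1) ℕ./ 2 ≡ h′
    half≡ = begin
      (p ℕ.∸ 1) ℕ./ 2     ≡⟨ cong (λ z → (z ℕ.∸ 1) ℕ./ 2) p≡ ⟩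
      (2 ℕ.* h′) ℕ./ 2    ≡⟨ cong (ℕ._/ 2) (ℕ.*-comm 2 h′) ⟩
      (h′ ℕ.* 2) ℕ./ 2    ≡⟨ ℕ.m*n/n≡m h′ 2 ⟩
      h′                  ∎

  sum-congruence : ∀ {p m} → Prime p → p ≡ suc (2 ℕ.* m) → 2 ≤ m →
    sumTo m term ≡ sign m * ℤ→ℚ (+ p) [modℚ p ^ 4 ]
  sum-congruence {p} {m} p-prime p≡1+2m 2≤m = mod-intro {sumTo m term} {sign m * ℤ→ℚ P} {p} {4} z a z∤ (begin
    (sumTo m term - sign m * ℤ→ℚ P) * ℤ→ℚ z              ≡⟨ distrib (sumTo m term) (sign m * ℤ→ℚ P) (ℤ→ℚ z) ⟩
    sumTo m term * ℤ→ℚ z - sign m * ℤ→ℚ P * ℤ→ℚ z        ≡⟨ cong₂ _-_ (sum-cleared m) main ⟩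
    ℤ→ℚ (N m 0ℤ) - ℤ→ℚ (sgn m ℤ.* P ℤ.* z)               ≡⟨ ℤ→ℚ-- (N m 0ℤ) (sgn m ℤ.* P ℤ.* z) ⟨
    ℤ→ℚ (N m 0ℤ ℤ.- sgn m ℤ.* P ℤ.* z)                   ≡⟨ cong ℤ→ℚ (proj₂ N-0-mod-P⁴) ⟩
    ℤ→ℚ (sq (sq P) ℤ.* a)                                ≡⟨ cong (λ q → ℤ→ℚ (q ℤ.* a)) (pos-^4 p) ⟨
    ℤ→ℚ (+ (p ℕ.^ 4) ℤ.* a)                              ≡⟨ ℤ→ℚ-* (+ (p ℕ.^ 4)) a ⟩
    ℤ→ℚ (+ (p ℕ.^ 4)) * ℤ→ℚ a                            ∎)
    where
    open ≡-Reasoning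
    open ModPrime p-prime
    open Congruence p-prime p≡1+2m 2≤m
    z = K m ℤ.* R m 0ℤ
    a = proj₁ N-0-mod-P⁴
    z∤ : ¬ (P ∣ℤ z)
    z∤ = ∤-* {K m} (K∤ m ℕ.≤-refl) (R0∤ m ℕ.≤-refl)
    distrib : ∀ x y z → (x - y) * z ≡ x * z - y * z
    distrib = solve 3 (λ x y z → (x :- y) :* z := x :* z :- y :* z) refl
      where open +-*-Solver
    main : sign m * ℤ→ℚ P * ℤ→ℚ z ≡ ℤ→ℚ (sgn m ℤ.* P ℤ.* z)
    main = sym (trans (ℤ→ℚ-* (sgn m ℤ.* P) z) (cong (_* ℤ→ℚ z)
             (trans (ℤ→ℚ-* (sgn m) P) (cong (_* ℤ→ℚ P) (sym (sign≡sgn m))))))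

open import Data.Nat using (_/_)
open import Data.Rational using (_*_)

theorem3 : (p : ℕ) → Prime p → 3 < p →
    sumTo ((p ∸ 1) / 2) term ≡ sign ((p ∸ 1) / 2) * ℤ→ℚ (+ p) [modℚ p ^ 4 ]
theorem3 p p-prime 3<p = Rational.sum-congruence {p} {(p ∸ 1) / 2} p-prime p≡1+2m
  -- 3 < 1 + 2m gives 2 · 1 < 2m, hence 2 ≤ m.
  (ℕ.*-cancelˡ-< 2 1 ((p ∸ 1) / 2) (ℕ.≤-pred (subst (3 <_) p≡1+2m 3<p)))
  where p≡1+2m = Rational.odd-prime p-prime 3<p
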